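{- Let $\eta=e^{\pi i/3}$ and consider the matrices with entries in $\mathbb{Z}/6\mathbb{Z}$ $$A=\begin{pmatrix}0&0&0&0&0&0\\0&0&2&2&4&4\\0&2&0&4&2&4\\0&2&4&0&4&2\\0&4&2&4&0&2\\0&4&4&2&2&0\end{pmatrix},\qquad B=\begin{pmatrix}0&0&0&0&0&0\\0&0&2&2&4&4\\0&0&4&4&2&2\\0&3&0&3&1&4\\0&3&2&5&5&2\\0&3&4&1&3&0\end{pmatrix}.$$ Let $H$ and $K$ be the $6\times6$ complex matrices with entries $H_{rs}=\eta^{A_{rs}}$ and $K_{rs}=\eta^{B_{rs}}$, with columns $h_0,\dots,h_5$ and $k_0,\dots,k_5$, respectively, and let $\Phi_{32}$ be the $6\times 6$ array of vectors with $(i,j)$ entry $\frac{1}{\sqrt6}(h_i\odot k_j)\in\mathbb{C}^6$, $0\le i,j\le5$. Then $\Phi_{32}$ is a quantum Latin square of order $6$ and its cardinality is $32$.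
   Context: For $x,y\in\mathbb{C}^n$, $x\odot y=(x_0y_0,\dots,x_{n-1}y_{n-1})^{\mathsf T}$ is the entrywise (Schur) product. A quantum Latin square of order $n$, denoted $\mathrm{QLS}(n)$, is an $n\times n$ array $(\phi_{ij})_{0\le i,j\le n-1}$ of unit vectors in $\mathbb{C}^n$ such that every row and every column forms an orthonormal basis of $\mathbb{C}^n$. Two unit vectors $u,v$ are phase equivalent, $u\sim v$, if $u=e^{i\alpha}v$ for some $\alpha\in\mathbb{R}$. The cardinality of a quantum Latin square is the number of distinct phase-equivalence classes among its $n^2$ entries. -}

module Defs where

open import Algebra.Bundles.Raw using (RawRing)
import Algebra.Definitions.RawSemiring as RawSemiringOps
open import Data.Fin.Base using (Fin; toℕ)
open import Data.Fin.Patterns using (0F; 1F; 2F; 3F; 4F; 5F)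
open import Data.Integer.Base as ℤ using (+_)
import Data.Integer.Properties as ℤ
open import Data.Integer.Solver using () renaming (module +-*-Solver to ℤ-Solver)
open import Data.Nat.Base as ℕ using (ℕ; zero; suc; z≤n; s≤s)
import Data.Nat.Properties as ℕ
open import Data.Nat.Solver using () renaming (module +-*-Solver to ℕ-Solver)
open import Data.Product.Base using (∃; _×_; _,_; proj₁; proj₂)
open import Data.Rational.Base as ℚ using (ℚ; mkℚ; 0ℚ; 1ℚ; ½; ∣_∣; *<*)
import Data.Rational.Properties as ℚ
open import Data.Rational.Solver using () renaming (module +-*-Solver to ℚ-Solver)
import Data.Rational.Unnormalised.Base as ℚᵘ
import Data.Rational.Unnormalised.Properties as ℚᵘ
open import Data.Sum.Base using (_⊎_; inj₁; inj₂)
open import Data.Vec.Base using (Vec; []; _∷_; lookup)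
open import Data.Vec.Functional using (Vector)
open import Function.Definitions using (Congruent; Bijective)
open import Level using (0ℓ)
open import Relation.Binary.PropositionalEquality
  using (_≡_; _≢_; refl; sym; trans; cong; subst; subst₂)
open import Relation.Nullary.Decidable using (Dec; yes; no)

private

  ½ε : ℚ → ℚ
  ½ε ε = ½ ℚ.* ε

  ½ε>0 : ∀ {ε} → 0ℚ ℚ.< ε → 0ℚ ℚ.< ½ε ε
  ½ε>0 {ε} 0<ε = ℚ.positive⁻¹ (½ ℚ.* ε) {{ℚ.pos*pos⇒pos ½ ε {{ℚ.positive 0<ε}}}}

  ½ε+½ε : ∀ ε → ½ε ε ℚ.+ ½ε ε ≡ ε
  ½ε+½ε ε = trans (sym (ℚ.*-distribʳ-+ ε ½ ½)) (ℚ.*-identityˡ ε)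

IsCauchy : (ℕ → ℚ) → Set
IsCauchy s = ∀ ε → 0ℚ ℚ.< ε →
  ∃ λ N → ∀ m n → N ℕ.≤ m → N ℕ.≤ n → ∣ s m ℚ.- s n ∣ ℚ.< ε

record ℝ : Set where
  constructor mkℝ
  field
    seq      : ℕ → ℚ
    isCauchy : IsCauchy seq

open ℝ public

infix 4 _≈ℝ_

record _≈ℝ_ (x y : ℝ) : Set where
  constructor mk≈ℝ
  field
    close : ∀ ε → 0ℚ ℚ.< ε →
            ∃ λ N → ∀ n → N ℕ.≤ n → ∣ seq x n ℚ.- seq y n ∣ ℚ.< ε

open _≈ℝ_ public

-- The convergence proofs are abstract: only the sequences should ever unfold.

abstract

  constant-cauchy : ∀ q → IsCauchy (λ _ → q)
  constant-cauchy q ε 0<ε = 0 , λ _ _ _ _ →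
    subst (ℚ._< ε) (cong ∣_∣ (sym (ℚ.+-inverseʳ q))) 0<ε

fromℚ : ℚ → ℝ
fromℚ q = mkℝ (λ _ → q) (constant-cauchy q)

0ℝ 1ℝ : ℝ
0ℝ = fromℚ 0ℚ
1ℝ = fromℚ 1ℚ

infixl 6 _+ℝ_
infixl 7 _*ℝ_
infix  8 -ℝ_

private

  +-cauchy : ∀ {s t} → IsCauchy s → IsCauchy t → IsCauchy (λ n → s n ℚ.+ t n)
  +-cauchy {s} {t} cs ct ε 0<ε = M ℕ.⊔ N , bound
    where
    M = proj₁ (cs (½ε ε) (½ε>0 0<ε))
    N = proj₁ (ct (½ε ε) (½ε>0 0<ε))

    rearrange : ∀ a b c d → (a ℚ.+ b) ℚ.- (c ℚ.+ d) ≡ (a ℚ.- c) ℚ.+ (b ℚ.- d)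
    rearrange = solve 4 (λ a b c d → (a :+ b) :- (c :+ d) := (a :- c) :+ (b :- d)) refl
      where open ℚ-Solver

    bound : ∀ m n → M ℕ.⊔ N ℕ.≤ m → M ℕ.⊔ N ℕ.≤ n →
            ∣ (s m ℚ.+ t m) ℚ.- (s n ℚ.+ t n) ∣ ℚ.< ε
    bound m n p q = begin-strict
      ∣ (s m ℚ.+ t m) ℚ.- (s n ℚ.+ t n) ∣
        ≡⟨ cong ∣_∣ (rearrange (s m) (t m) (s n) (t n)) ⟩
      ∣ (s m ℚ.- s n) ℚ.+ (t m ℚ.- t n) ∣
        ≤⟨ ℚ.∣p+q∣≤∣p∣+∣q∣ (s m ℚ.- s n) (t m ℚ.- t n) ⟩
      ∣ s m ℚ.- s n ∣ ℚ.+ ∣ t m ℚ.- t n ∣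
        <⟨ ℚ.+-mono-<
             (proj₂ (cs (½ε ε) (½ε>0 0<ε)) m n (ℕ.m⊔n≤o⇒m≤o M N p) (ℕ.m⊔n≤o⇒m≤o M N q))
             (proj₂ (ct (½ε ε) (½ε>0 0<ε)) m n (ℕ.m⊔n≤o⇒n≤o M N p) (ℕ.m⊔n≤o⇒n≤o M N q)) ⟩
      ½ε ε ℚ.+ ½ε ε
        ≡⟨ ½ε+½ε ε ⟩
      ε ∎
      where open ℚ.≤-Reasoning

  -‿cauchy : ∀ {s} → IsCauchy s → IsCauchy (λ n → ℚ.- s n)
  -‿cauchy {s} cs ε 0<ε = proj₁ (cs ε 0<ε) , λ m n p q →
    subst (ℚ._< ε) (sym (eq (s m) (s n))) (proj₂ (cs ε 0<ε) m n p q)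
    where
    neg : ∀ a b → (ℚ.- a) ℚ.- (ℚ.- b) ≡ ℚ.- (a ℚ.- b)
    neg = solve 2 (λ a b → (:- a) :- (:- b) := :- (a :- b)) refl
      where open ℚ-Solver

    eq : ∀ a b → ∣ (ℚ.- a) ℚ.- (ℚ.- b) ∣ ≡ ∣ a ℚ.- b ∣
    eq a b = trans (cong ∣_∣ (neg a b)) (ℚ.∣-p∣≡∣p∣ (a ℚ.- b))

EventuallyBoundedBy : ℚ → (ℕ → ℚ) → Set
EventuallyBoundedBy B s = ∃ λ N → ∀ n → N ℕ.≤ n → ∣ s n ∣ ℚ.≤ B

cauchy⇒bounded : ∀ {s} → IsCauchy s → ∃ λ B → ℚ.Positive B × EventuallyBoundedBy B s
cauchy⇒bounded {s} cs = B , B>0 , N , bound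
  where
  N = proj₁ (cs 1ℚ (ℚ.positive⁻¹ 1ℚ))
  B = 1ℚ ℚ.+ ∣ s N ∣

  B>0 : ℚ.Positive B
  B>0 = ℚ.pos+nonNeg⇒pos 1ℚ ∣ s N ∣ {{ℚ.∣-∣-nonNeg (s N)}}

  split : ∀ a b → a ≡ (a ℚ.- b) ℚ.+ b
  split = solve 2 (λ a b → a := (a :- b) :+ b) refl
    where open ℚ-Solver

  bound : ∀ n → N ℕ.≤ n → ∣ s n ∣ ℚ.≤ B
  bound n N≤n = begin
    ∣ s n ∣                         ≡⟨ cong ∣_∣ (split (s n) (s N)) ⟩
    ∣ (s n ℚ.- s N) ℚ.+ s N ∣       ≤⟨ ℚ.∣p+q∣≤∣p∣+∣q∣ (s n ℚ.- s N) (s N) ⟩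
    ∣ s n ℚ.- s N ∣ ℚ.+ ∣ s N ∣     ≤⟨ ℚ.+-monoˡ-≤ ∣ s N ∣ (ℚ.<⇒≤
                                         (proj₂ (cs 1ℚ (ℚ.positive⁻¹ 1ℚ)) n N N≤n ℕ.≤-refl)) ⟩
    B                               ∎
    where open ℚ.≤-Reasoning

private

  shrink : ∀ B → .{{ℚ.Positive B}} → ℚ → ℚ
  shrink B ε = (ℚ.1/ B) {{ℚ.pos⇒nonZero B}} ℚ.* ½ε ε

  shrink>0 : ∀ B .{{_ : ℚ.Positive B}} {ε} → 0ℚ ℚ.< ε → 0ℚ ℚ.< shrink B ε
  shrink>0 B {ε} 0<ε = ℚ.positive⁻¹ (shrink B ε)
    {{ℚ.pos*pos⇒pos ((ℚ.1/ B) {{ℚ.pos⇒nonZero B}}) {{ℚ.1/pos⇒pos B}}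
                    (½ε ε) {{ℚ.positive (½ε>0 0<ε)}}}}

  *-shrink : ∀ B .{{_ : ℚ.Positive B}} ε → B ℚ.* shrink B ε ≡ ½ε ε
  *-shrink B ε = trans (sym (ℚ.*-assoc B _ (½ε ε)))
    (trans (cong (ℚ._* ½ε ε) (ℚ.*-inverseʳ B {{ℚ.pos⇒nonZero B}}))
           (ℚ.*-identityˡ (½ε ε)))

  small-product : ∀ B .{{_ : ℚ.Positive B}} ε a d →
    ∣ a ∣ ℚ.≤ B → ∣ d ∣ ℚ.< shrink B ε → ∣ a ℚ.* d ∣ ℚ.< ½ε ε
  small-product B ε a d a≤B d< = begin-strict
    ∣ a ℚ.* d ∣       ≡⟨ ℚ.∣p*q∣≡∣p∣*∣q∣ a d ⟩
    ∣ a ∣ ℚ.* ∣ d ∣   ≤⟨ ℚ.*-monoʳ-≤-nonNeg ∣ d ∣ {{ℚ.∣-∣-nonNeg d}} a≤B ⟩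
    B ℚ.* ∣ d ∣       <⟨ ℚ.*-monoʳ-<-pos B d< ⟩
    B ℚ.* shrink B ε  ≡⟨ *-shrink B ε ⟩
    ½ε ε              ∎
    where open ℚ.≤-Reasoning

  rearrange-* : ∀ a b c d → a ℚ.* b ℚ.- c ℚ.* d ≡ a ℚ.* (b ℚ.- d) ℚ.+ d ℚ.* (a ℚ.- c)
  rearrange-* = solve 4 (λ a b c d → a :* b :- c :* d := a :* (b :- d) :+ d :* (a :- c)) refl
    where open ℚ-Solver

  product-close : ∀ B .{{_ : ℚ.Positive B}} C .{{_ : ℚ.Positive C}} ε a b c d →
    ∣ a ∣ ℚ.≤ B → ∣ d ∣ ℚ.≤ C → ∣ a ℚ.- c ∣ ℚ.< shrink C ε → ∣ b ℚ.- d ∣ ℚ.< shrink B ε →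
    ∣ a ℚ.* b ℚ.- c ℚ.* d ∣ ℚ.< ε
  product-close B C ε a b c d a≤B d≤C a-c b-d = begin-strict
    ∣ a ℚ.* b ℚ.- c ℚ.* d ∣
      ≡⟨ cong ∣_∣ (rearrange-* a b c d) ⟩
    ∣ a ℚ.* (b ℚ.- d) ℚ.+ d ℚ.* (a ℚ.- c) ∣
      ≤⟨ ℚ.∣p+q∣≤∣p∣+∣q∣ (a ℚ.* (b ℚ.- d)) (d ℚ.* (a ℚ.- c)) ⟩
    ∣ a ℚ.* (b ℚ.- d) ∣ ℚ.+ ∣ d ℚ.* (a ℚ.- c) ∣
      <⟨ ℚ.+-mono-< (small-product B ε a (b ℚ.- d) a≤B b-d)
                    (small-product C ε d (a ℚ.- c) d≤C a-c) ⟩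
    ½ε ε ℚ.+ ½ε ε
      ≡⟨ ½ε+½ε ε ⟩
    ε ∎
    where open ℚ.≤-Reasoning

  *-cauchy-bounded : ∀ s t B .{{_ : ℚ.Positive B}} C .{{_ : ℚ.Positive C}} →
    EventuallyBoundedBy B s → EventuallyBoundedBy C t →
    IsCauchy s → IsCauchy t → IsCauchy (λ n → s n ℚ.* t n)
  *-cauchy-bounded s t B C (M₁ , s≤B) (N₁ , t≤C) cs ct ε 0<ε =
    (M₁ ℕ.⊔ N₁) ℕ.⊔ (M₂ ℕ.⊔ N₂) , λ m n p q →
    product-close B C ε (s m) (t m) (s n) (t n)
      (s≤B m (ℕ.m⊔n≤o⇒m≤o M₁ N₁ (first p)))
      (t≤C n (ℕ.m⊔n≤o⇒n≤o M₁ N₁ (first q)))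
      (proj₂ smallS m n (ℕ.m⊔n≤o⇒m≤o M₂ N₂ (second p)) (ℕ.m⊔n≤o⇒m≤o M₂ N₂ (second q)))
      (proj₂ smallT m n (ℕ.m⊔n≤o⇒n≤o M₂ N₂ (second p)) (ℕ.m⊔n≤o⇒n≤o M₂ N₂ (second q)))
    where
    smallS = cs (shrink C ε) (shrink>0 C 0<ε)
    smallT = ct (shrink B ε) (shrink>0 B 0<ε)
    M₂ = proj₁ smallS
    N₂ = proj₁ smallT

    first : ∀ {n} → (M₁ ℕ.⊔ N₁) ℕ.⊔ (M₂ ℕ.⊔ N₂) ℕ.≤ n → M₁ ℕ.⊔ N₁ ℕ.≤ n
    first = ℕ.m⊔n≤o⇒m≤o (M₁ ℕ.⊔ N₁) (M₂ ℕ.⊔ N₂)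

    second : ∀ {n} → (M₁ ℕ.⊔ N₁) ℕ.⊔ (M₂ ℕ.⊔ N₂) ℕ.≤ n → M₂ ℕ.⊔ N₂ ℕ.≤ n
    second = ℕ.m⊔n≤o⇒n≤o (M₁ ℕ.⊔ N₁) (M₂ ℕ.⊔ N₂)

  *-cauchy : ∀ {s t} → IsCauchy s → IsCauchy t → IsCauchy (λ n → s n ℚ.* t n)
  *-cauchy {s} {t} cs ct = from-bounds (cauchy⇒bounded cs) (cauchy⇒bounded ct)
    where
    from-bounds : (∃ λ B → ℚ.Positive B × EventuallyBoundedBy B s) →
                  (∃ λ C → ℚ.Positive C × EventuallyBoundedBy C t) →
                  IsCauchy (λ n → s n ℚ.* t n)
    from-bounds (B , B>0 , s≤B) (C , C>0 , t≤C) =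
      *-cauchy-bounded s t B {{B>0}} C {{C>0}} s≤B t≤C cs ct

abstract

  +-isCauchy : ∀ x y → IsCauchy (λ n → seq x n ℚ.+ seq y n)
  +-isCauchy x y = +-cauchy {seq x} {seq y} (isCauchy x) (isCauchy y)

  *-isCauchy : ∀ x y → IsCauchy (λ n → seq x n ℚ.* seq y n)
  *-isCauchy x y = *-cauchy {seq x} {seq y} (isCauchy x) (isCauchy y)

  -‿isCauchy : ∀ x → IsCauchy (λ n → ℚ.- seq x n)
  -‿isCauchy x = -‿cauchy {seq x} (isCauchy x)

_+ℝ_ _*ℝ_ : ℝ → ℝ → ℝ
x +ℝ y = mkℝ (λ n → seq x n ℚ.+ seq y n) (+-isCauchy x y)
x *ℝ y = mkℝ (λ n → seq x n ℚ.* seq y n) (*-isCauchy x y)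

-ℝ_ : ℝ → ℝ
-ℝ x = mkℝ (λ n → ℚ.- seq x n) (-‿isCauchy x)

private

  isqrt-step : (a m : ℕ) → Dec (suc a ℕ.* suc a ℕ.≤ m) → ℕ
  isqrt-step a m (yes _) = suc a
  isqrt-step a m (no  _) = a

-- isqrt m = ⌊ √m ⌋

isqrt : ℕ → ℕ
isqrt zero    = 0
isqrt (suc m) = isqrt-step (isqrt m) (suc m) (suc (isqrt m) ℕ.* suc (isqrt m) ℕ.≤? suc m)

isqrt-lower : ∀ m → isqrt m ℕ.* isqrt m ℕ.≤ m
isqrt-lower zero = z≤n
isqrt-lower (suc m) with suc (isqrt m) ℕ.* suc (isqrt m) ℕ.≤? suc m
... | yes p = p
... | no  _ = ℕ.m≤n⇒m≤1+n (isqrt-lower m)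

isqrt-upper : ∀ m → m ℕ.< suc (isqrt m) ℕ.* suc (isqrt m)
isqrt-upper zero = s≤s z≤n
isqrt-upper (suc m) with suc (isqrt m) ℕ.* suc (isqrt m) ℕ.≤? suc m
... | yes _ = ℕ.≤-<-trans (isqrt-upper m)
                (ℕ.*-mono-< (ℕ.n<1+n (suc (isqrt m))) (ℕ.n<1+n (suc (isqrt m))))
... | no ¬p = ℕ.≰⇒> ¬p

-- The k-th approximation is √n rounded down to a multiple of 1/(k+1).

√-seq : ℕ → ℕ → ℚ
√-seq n k = (+ isqrt (n ℕ.* (suc k ℕ.* suc k))) ℚ./ suc k

private

  toℚᵘ-/ : ∀ a k → ℚ.toℚᵘ (a ℚ./ suc k) ℚᵘ.≃ ℚᵘ.mkℚᵘ a k
  toℚᵘ-/ a k = ℚ.toℚᵘ-fromℚᵘ (ℚᵘ.mkℚᵘ a k)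

  square-cancel-< : ∀ a b → a ℕ.* a ℕ.< b ℕ.* b → a ℕ.< b
  square-cancel-< a b aa<bb = ℕ.≰⇒> λ b≤a → ℕ.<⇒≱ aa<bb (ℕ.*-mono-≤ b≤a b≤a)

  square-* : ∀ a b → (a ℕ.* b) ℕ.* (a ℕ.* b) ≡ (a ℕ.* a) ℕ.* (b ℕ.* b)
  square-* = solve 2 (λ a b → (a :* b) :* (a :* b) := (a :* a) :* (b :* b)) refl
    where open ℕ-Solver

  swap-* : ∀ n a b → (n ℕ.* a) ℕ.* b ≡ (n ℕ.* b) ℕ.* a
  swap-* = solve 3 (λ n a b → (n :* a) :* b := (n :* b) :* a) refl
    where open ℕ-Solver

  √-cross : ∀ n j k →
    isqrt (n ℕ.* (suc j ℕ.* suc j)) ℕ.* suc k ℕ.< suc (isqrt (n ℕ.* (suc k ℕ.* suc k))) ℕ.* suc j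
  √-cross n j k = square-cancel-< (a ℕ.* K) (suc b ℕ.* J) (begin-strict
    (a ℕ.* K) ℕ.* (a ℕ.* K)          ≡⟨ square-* a K ⟩
    (a ℕ.* a) ℕ.* (K ℕ.* K)          ≤⟨ ℕ.*-monoˡ-≤ (K ℕ.* K) (isqrt-lower (n ℕ.* (J ℕ.* J))) ⟩
    (n ℕ.* (J ℕ.* J)) ℕ.* (K ℕ.* K)  ≡⟨ swap-* n (J ℕ.* J) (K ℕ.* K) ⟩
    (n ℕ.* (K ℕ.* K)) ℕ.* (J ℕ.* J)  <⟨ ℕ.*-monoˡ-< (J ℕ.* J) (isqrt-upper (n ℕ.* (K ℕ.* K))) ⟩
    (suc b ℕ.* suc b) ℕ.* (J ℕ.* J)  ≡⟨ square-* (suc b) J ⟨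
    (suc b ℕ.* J) ℕ.* (suc b ℕ.* J)  ∎)
    where
    open ℕ.≤-Reasoning
    J = suc j
    K = suc k
    a = isqrt (n ℕ.* (J ℕ.* J))
    b = isqrt (n ℕ.* (K ℕ.* K))

  /-mono-< : ∀ a j b k → a ℕ.* suc k ℕ.< b ℕ.* suc j → (+ a) ℚ./ suc j ℚ.< (+ b) ℚ./ suc k
  /-mono-< a j b k lt = ℚ.toℚᵘ-cancel-< (begin-strict
    ℚ.toℚᵘ ((+ a) ℚ./ suc j)  ≃⟨ toℚᵘ-/ (+ a) j ⟩
    ℚᵘ.mkℚᵘ (+ a) j           <⟨ ℚᵘ.*<* (subst₂ ℤ._<_ (ℤ.pos-* a (suc k)) (ℤ.pos-* b (suc j)) (ℤ.+<+ lt)) ⟩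
    ℚᵘ.mkℚᵘ (+ b) k           ≃⟨ toℚᵘ-/ (+ b) k ⟨
    ℚ.toℚᵘ ((+ b) ℚ./ suc k)  ∎)
    where open ℚᵘ.≤-Reasoning

  suc-/ : ∀ b k → (+ suc b) ℚ./ suc k ≡ (+ b) ℚ./ suc k ℚ.+ (+ 1) ℚ./ suc k
  suc-/ b k = ℚ.toℚᵘ-injective (begin-equality
    ℚ.toℚᵘ ((+ suc b) ℚ./ suc k)
      ≃⟨ toℚᵘ-/ (+ suc b) k ⟩
    ℚᵘ.mkℚᵘ (+ suc b) k
      ≃⟨ ℚᵘ.*≡* (eq (+ b) (+ suc k)) ⟩
    ℚᵘ.mkℚᵘ (+ b) k ℚᵘ.+ ℚᵘ.mkℚᵘ (+ 1) k
      ≃⟨ ℚᵘ.+-cong (toℚᵘ-/ (+ b) k) (toℚᵘ-/ (+ 1) k) ⟨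
    ℚ.toℚᵘ ((+ b) ℚ./ suc k) ℚᵘ.+ ℚ.toℚᵘ ((+ 1) ℚ./ suc k)
      ≃⟨ ℚ.toℚᵘ-homo-+ ((+ b) ℚ./ suc k) ((+ 1) ℚ./ suc k) ⟨
    ℚ.toℚᵘ ((+ b) ℚ./ suc k ℚ.+ (+ 1) ℚ./ suc k) ∎)
    where
    open ℚᵘ.≤-Reasoning
    eq : ∀ b d → (ℤ.1ℤ ℤ.+ b) ℤ.* (d ℤ.* d) ≡ (b ℤ.* d ℤ.+ ℤ.1ℤ ℤ.* d) ℤ.* d
    eq = solve 2 (λ b d → (con ℤ.1ℤ :+ b) :* (d :* d) := (b :* d :+ con ℤ.1ℤ :* d) :* d) refl
      where open ℤ-Solver

  1/suc-small : ∀ ε → 0ℚ ℚ.< ε → ∃ λ N → ∀ k → N ℕ.≤ k → (+ 1) ℚ./ suc k ℚ.< ε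
  1/suc-small (mkℚ (+ zero)    q c) (*<* (ℤ.+<+ ()))
  1/suc-small (mkℚ (ℤ.-[1+ _ ]) q c) (*<* ())
  1/suc-small (mkℚ (+ suc p) q c) _ = suc q , λ k q<k → ℚ.toℚᵘ-cancel-< (begin-strict
    ℚ.toℚᵘ ((+ 1) ℚ./ suc k)  ≃⟨ toℚᵘ-/ (+ 1) k ⟩
    ℚᵘ.mkℚᵘ (+ 1) k           <⟨ ℚᵘ.*<* (subst₂ ℤ._<_ (ℤ.pos-* 1 (suc q)) (ℤ.pos-* (suc p) (suc k))
                                   (ℤ.+<+ (ℕ.≤-<-trans (ℕ.≤-reflexive (ℕ.*-identityˡ (suc q)))
                                     (ℕ.<-≤-trans (s≤s q<k) (ℕ.m≤n*m (suc k) (suc p)))))) ⟩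
    ℚᵘ.mkℚᵘ (+ suc p) q       ∎)
    where open ℚᵘ.≤-Reasoning

  <⇒∣-∣< : ∀ a b c d ε → a ℚ.< b ℚ.+ c → b ℚ.< a ℚ.+ d → c ℚ.< ε → d ℚ.< ε → ∣ a ℚ.- b ∣ ℚ.< ε
  <⇒∣-∣< a b c d ε a< b< c<ε d<ε = case (ℚ.∣p∣≡p∨∣p∣≡-p (a ℚ.- b))
    where
    cancel : ∀ b c → (b ℚ.+ c) ℚ.- b ≡ c
    cancel = solve 2 (λ b c → (b :+ c) :- b := c) refl
      where open ℚ-Solver

    flip-sub : ∀ a b → ℚ.- (a ℚ.- b) ≡ b ℚ.- a
    flip-sub = solve 2 (λ a b → :- (a :- b) := b :- a) refl
      where open ℚ-Solver

    sub-< : ∀ a b c → a ℚ.< b ℚ.+ c → a ℚ.- b ℚ.< c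
    sub-< a b c lt = subst (a ℚ.- b ℚ.<_) (cancel b c) (ℚ.+-monoˡ-< (ℚ.- b) lt)

    case : (∣ a ℚ.- b ∣ ≡ a ℚ.- b) ⊎ (∣ a ℚ.- b ∣ ≡ ℚ.- (a ℚ.- b)) → ∣ a ℚ.- b ∣ ℚ.< ε
    case (inj₁ eq) = subst (ℚ._< ε) (sym eq) (ℚ.<-trans (sub-< a b c a<) c<ε)
    case (inj₂ eq) = subst (ℚ._< ε) (sym (trans eq (flip-sub a b)))
                       (ℚ.<-trans (sub-< b a d b<) d<ε)

  √-seq-< : ∀ n j k → √-seq n j ℚ.< √-seq n k ℚ.+ (+ 1) ℚ./ suc k
  √-seq-< n j k = subst (√-seq n j ℚ.<_) (suc-/ b k) (/-mono-< a j (suc b) k (√-cross n j k))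
    where
    a = isqrt (n ℕ.* (suc j ℕ.* suc j))
    b = isqrt (n ℕ.* (suc k ℕ.* suc k))

  √-cauchy : ∀ n → IsCauchy (√-seq n)
  √-cauchy n ε 0<ε = proj₁ small , λ j k N≤j N≤k →
    <⇒∣-∣< (√-seq n j) (√-seq n k) ((+ 1) ℚ./ suc k) ((+ 1) ℚ./ suc j) ε
      (√-seq-< n j k) (√-seq-< n k j)
      (proj₂ small k N≤k) (proj₂ small j N≤j)
    where small = 1/suc-small ε 0<ε

abstract

  √-isCauchy : ∀ n → IsCauchy (√-seq n)
  √-isCauchy = √-cauchy

√_ : ℕ → ℝ
√ n = mkℝ (√-seq n) (√-isCauchy n)

record ℂ : Set where
  constructor _+i_
  field
    re im : ℝ

open ℂ public

infix 5 _+i_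
infix 4 _≈ℂ_

record _≈ℂ_ (z w : ℂ) : Set where
  constructor mk≈ℂ
  field
    re-≈ : re z ≈ℝ re w
    im-≈ : im z ≈ℝ im w

open _≈ℂ_ public

ℂ-rawRing : RawRing 0ℓ 0ℓ
ℂ-rawRing = record
  { Carrier = ℂ
  ; _≈_     = _≈ℂ_
  ; _+_     = λ z w → (re z +ℝ re w) +i (im z +ℝ im w)
  ; _*_     = λ z w → (re z *ℝ re w +ℝ -ℝ (im z *ℝ im w)) +i (re z *ℝ im w +ℝ im z *ℝ re w)
  ; -_      = λ z → (-ℝ re z) +i (-ℝ im z)
  ; 0#      = 0ℝ +i 0ℝ
  ; 1#      = 1ℝ +i 0ℝ
  }

open RawRing ℂ-rawRing public
  using (_≈_; _+_; _*_; -_)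
  renaming (0# to 0ℂ; 1# to 1ℂ)

open RawSemiringOps (RawRing.rawSemiring ℂ-rawRing) public
  using (_^_; sum)

fromℝ : ℝ → ℂ
fromℝ x = x +i 0ℝ

conj : ℂ → ℂ
conj z = re z +i (-ℝ im z)

-- normSq z = ∣ z ∣²

normSq : ℂ → ℝ
normSq z = re z *ℝ re z +ℝ im z *ℝ im z

infixl 7 _⊙_ _·_

_⊙_ : ∀ {n} → Vector ℂ n → Vector ℂ n → Vector ℂ n
(u ⊙ v) k = u k * v k

_·_ : ∀ {n} → ℂ → Vector ℂ n → Vector ℂ n
(c · v) k = c * v k

infix 4 _≋_

_≋_ : ∀ {n} → Vector ℂ n → Vector ℂ n → Set
u ≋ v = ∀ k → u k ≈ v k

⟨_,_⟩ : ∀ {n} → Vector ℂ n → Vector ℂ n → ℂ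
⟨ u , v ⟩ = sum λ k → conj (u k) * v k

-- ‖ v ‖ = 1, stated as ‖ v ‖² = 1

IsUnit : ∀ {n} → Vector ℂ n → Set
IsUnit v = ⟨ v , v ⟩ ≈ 1ℂ

linearCombination : ∀ {m n} → Vector ℂ m → Vector (Vector ℂ n) m → Vector ℂ n
linearCombination c b k = sum λ i → c i * b i k

record IsOrthonormalBasis {n} (b : Vector (Vector ℂ n) n) : Set where
  field
    unit        : ∀ i → IsUnit (b i)
    orthogonal  : ∀ i j → i ≢ j → ⟨ b i , b j ⟩ ≈ 0ℂ
    spanning    : ∀ v → ∃ λ c → linearCombination c b ≋ v
    independent : ∀ c → linearCombination c b ≋ (λ _ → 0ℂ) → ∀ i → c i ≈ 0ℂ

Array : ℕ → Set
Array n = Fin n → Fin n → Vector ℂ n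

record IsQuantumLatinSquare {n} (φ : Array n) : Set where
  field
    unit    : ∀ i j → IsUnit (φ i j)
    rows    : ∀ i → IsOrthonormalBasis (λ j → φ i j)
    columns : ∀ j → IsOrthonormalBasis (λ i → φ i j)

-- The phases e^{iα}, α ∈ ℝ, are exactly the complex numbers of modulus 1.

infix 4 _∼_

_∼_ : ∀ {n} → Vector ℂ n → Vector ℂ n → Set
u ∼ v = ∃ λ c → normSq c ≈ℝ 1ℝ × u ≋ c · v

SamePhaseClass : ∀ {n} → Array n → Fin n × Fin n → Fin n × Fin n → Set
SamePhaseClass φ (i , j) (k , l) = φ i j ∼ φ k l

-- φ has exactly N phase classes: some labelling of the entries by Fin N is a
-- bijection from the entries taken up to ∼.

HasCardinality : ∀ {n} → Array n → ℕ → Set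
HasCardinality {n} φ N = ∃ λ (f : Fin n × Fin n → Fin N) →
  Congruent (SamePhaseClass φ) _≡_ f × Bijective (SamePhaseClass φ) _≡_ f

-- η = e^{πi/3} = 1/2 + (√3/2) i

η : ℂ
η = fromℚ ½ +i (fromℚ ½ *ℝ √ 3)

-- 1/√6 = √6/6

1/√6 : ℝ
1/√6 = fromℚ ((+ 1) ℚ./ 6) *ℝ √ 6

-- Fin 6 stands for ℤ/6ℤ; powers of η depend only on the exponent mod 6.

A B : Vec (Vec (Fin 6) 6) 6
A = (0F ∷ 0F ∷ 0F ∷ 0F ∷ 0F ∷ 0F ∷ [])
  ∷ (0F ∷ 0F ∷ 2F ∷ 2F ∷ 4F ∷ 4F ∷ [])
  ∷ (0F ∷ 2F ∷ 0F ∷ 4F ∷ 2F ∷ 4F ∷ [])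
  ∷ (0F ∷ 2F ∷ 4F ∷ 0F ∷ 4F ∷ 2F ∷ [])
  ∷ (0F ∷ 4F ∷ 2F ∷ 4F ∷ 0F ∷ 2F ∷ [])
  ∷ (0F ∷ 4F ∷ 4F ∷ 2F ∷ 2F ∷ 0F ∷ [])
  ∷ []
B = (0F ∷ 0F ∷ 0F ∷ 0F ∷ 0F ∷ 0F ∷ [])
  ∷ (0F ∷ 0F ∷ 2F ∷ 2F ∷ 4F ∷ 4F ∷ [])
  ∷ (0F ∷ 0F ∷ 4F ∷ 4F ∷ 2F ∷ 2F ∷ [])
  ∷ (0F ∷ 3F ∷ 0F ∷ 3F ∷ 1F ∷ 4F ∷ [])
  ∷ (0F ∷ 3F ∷ 2F ∷ 5F ∷ 5F ∷ 2F ∷ [])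
  ∷ (0F ∷ 3F ∷ 4F ∷ 1F ∷ 3F ∷ 0F ∷ [])
  ∷ []

η-power : Vec (Vec (Fin 6) 6) 6 → Fin 6 → Fin 6 → ℂ
η-power M r s = η ^ toℕ (lookup (lookup M r) s)

H K : Fin 6 → Fin 6 → ℂ
H = η-power A
K = η-power B

column : (Fin 6 → Fin 6 → ℂ) → Fin 6 → Vector ℂ 6
column M s r = M r s

Φ₃₂ : Array 6
Φ₃₂ i j = fromℝ 1/√6 · (column H i ⊙ column K j)

{-# OPTIONS --safe #-}
module Submission where

-- Every number occurring is, up to the factor 1/√6, an element of ℚ(√-3), which
-- embeds in ℂ. Exact arithmetic there verifies that each row and each column of
-- Φ₃₂ is, up to that factor, a complex Hadamard matrix; and since row 0 of H and
-- of K is constantly 1, phase-equivalent entries are equal, so that the phase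
-- classes are counted by comparing exact vectors.

open import Defs
open import Algebra.Bundles using (CommutativeSemiring)
open import Algebra.Bundles.Raw using (RawRing)
import Algebra.Definitions.RawSemiring as RawSemiringOps
import Algebra.Properties.Semiring.Sum as SemiringSum
open import Algebra.Structures.Biased using (isCommutativeSemiringˡ)
open import Data.Fin using (#_)
open import Data.Fin.Base using (Fin; zero; suc; toℕ)
open import Data.Fin.Patterns using (0F)
open import Data.Fin.Properties as Fin using (all?; any?)
open import Data.Integer.Base as ℤ using (+_)
import Data.Integer.Properties as ℤ
open import Data.Integer.Solver using () renaming (module +-*-Solver to ℤ-Solver)
open import Data.Nat.Base as ℕ using (ℕ; zero; suc)
import Data.Nat.Properties as ℕ
open import Data.Nat.Solver using () renaming (module +-*-Solver to ℕ-Solver)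
open import Data.Product.Base using (∃; _×_; _,_; proj₁; proj₂)
open import Data.Product.Properties using (≡-dec)
open import Data.Rational.Base as ℚ using (ℚ; mkℚ; 0ℚ; 1ℚ; ½; ∣_∣; _/_; *<*)
import Data.Rational.Properties as ℚ
open import Data.Rational.Solver using () renaming (module +-*-Solver to ℚ-Solver)
import Data.Rational.Unnormalised.Base as ℚᵘ
import Data.Rational.Unnormalised.Properties as ℚᵘ
open import Data.Sum.Base using ([_,_]′)
open import Data.Vec.Base using (Vec; []; _∷_; lookup)
open import Data.Vec.Functional using (Vector)
open import Level using (0ℓ)
open import Relation.Binary.Definitions using (DecidableEquality)
open import Relation.Binary.PropositionalEquality
  using (_≡_; _≢_; refl; sym; trans; cong; cong₂; subst; subst₂; _≗_)
import Relation.Binary.Reasoning.Setoid as SetoidReasoning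
open import Relation.Binary.Structures using (IsEquivalence)
open import Relation.Nullary.Decidable using (Dec; from-yes; decidable-stable; _→-dec_; _×-dec_)
open import Relation.Nullary.Negation using (contradiction)

-- Null sequences, and equality of Cauchy reals as a congruence

Null : (ℕ → ℚ) → Set
Null d = ∀ ε → 0ℚ ℚ.< ε → ∃ λ N → ∀ n → N ℕ.≤ n → ∣ d n ∣ ℚ.< ε

-- The field `close` of `x ≈ℝ y` is exactly `Null` of the termwise difference. Each congruence law
-- below rewrites a difference by a rational identity and then applies a closure property of null
-- sequences.
Null-resp-≗ : ∀ {d e} → d ≗ e → Null d → Null e
Null-resp-≗ d≗e nd ε 0<ε = proj₁ (nd ε 0<ε) , λ n N≤n →
  subst (λ q → ∣ q ∣ ℚ.< ε) (d≗e n) (proj₂ (nd ε 0<ε) n N≤n)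

Null-0 : Null (λ _ → 0ℚ)
Null-0 ε 0<ε = 0 , λ _ _ → 0<ε

Null-+ : ∀ {d e} → Null d → Null e → Null (λ n → d n ℚ.+ e n)
Null-+ {d} {e} nd ne ε 0<ε = M ℕ.⊔ N , λ n p → begin-strict
  ∣ d n ℚ.+ e n ∣        ≤⟨ ℚ.∣p+q∣≤∣p∣+∣q∣ (d n) (e n) ⟩
  ∣ d n ∣ ℚ.+ ∣ e n ∣    <⟨ ℚ.+-mono-< (proj₂ (nd ½ε 0<½ε) n (ℕ.m⊔n≤o⇒m≤o M N p))
                                       (proj₂ (ne ½ε 0<½ε) n (ℕ.m⊔n≤o⇒n≤o M N p)) ⟩
  ½ε ℚ.+ ½ε              ≡⟨ ℚ.*-distribʳ-+ ε ½ ½ ⟨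
  1ℚ ℚ.* ε               ≡⟨ ℚ.*-identityˡ ε ⟩
  ε                      ∎
  where
  open ℚ.≤-Reasoning
  ½ε = ½ ℚ.* ε

  0<½ε : 0ℚ ℚ.< ½ε
  0<½ε = ℚ.positive⁻¹ ½ε {{ℚ.pos*pos⇒pos ½ ε {{ℚ.positive 0<ε}}}}

  M = proj₁ (nd ½ε 0<½ε)
  N = proj₁ (ne ½ε 0<½ε)

-- The tolerance ε/b is demanded of `d`, so that the bound `b` on `s` cancels.
Null-*ˡ : ∀ {s d} b .{{_ : ℚ.Positive b}} → EventuallyBoundedBy b s → Null d →
          Null (λ n → s n ℚ.* d n)
Null-*ˡ {s} {d} b (M , s≤b) nd ε 0<ε = M ℕ.⊔ N , λ n p → begin-strict
  ∣ s n ℚ.* d n ∣        ≡⟨ ℚ.∣p*q∣≡∣p∣*∣q∣ (s n) (d n) ⟩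
  ∣ s n ∣ ℚ.* ∣ d n ∣    ≤⟨ ℚ.*-monoʳ-≤-nonNeg ∣ d n ∣ {{ℚ.∣-∣-nonNeg (d n)}}
                              (s≤b n (ℕ.m⊔n≤o⇒m≤o M N p)) ⟩
  b ℚ.* ∣ d n ∣          <⟨ ℚ.*-monoʳ-<-pos b (proj₂ (nd ε/b 0<ε/b) n (ℕ.m⊔n≤o⇒n≤o M N p)) ⟩
  b ℚ.* ε/b              ≡⟨ ℚ.*-assoc b 1/b ε ⟨
  (b ℚ.* 1/b) ℚ.* ε      ≡⟨ cong (ℚ._* ε) (ℚ.*-inverseʳ b {{ℚ.pos⇒nonZero b}}) ⟩
  1ℚ ℚ.* ε               ≡⟨ ℚ.*-identityˡ ε ⟩
  ε                      ∎
  where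
  open ℚ.≤-Reasoning
  1/b = (ℚ.1/ b) {{ℚ.pos⇒nonZero b}}
  ε/b = 1/b ℚ.* ε

  0<ε/b : 0ℚ ℚ.< ε/b
  0<ε/b = ℚ.positive⁻¹ ε/b {{ℚ.pos*pos⇒pos 1/b {{ℚ.1/pos⇒pos b}} ε {{ℚ.positive 0<ε}}}}

  N = proj₁ (nd ε/b 0<ε/b)

-- The operations on reals act termwise, so ring identities reduce to identities in ℚ at each index,
-- with no limit argument.
≗⇒≈ℝ : ∀ {x y} → seq x ≗ seq y → x ≈ℝ y
≗⇒≈ℝ {x} {y} x≗y = mk≈ℝ (Null-resp-≗ (λ n →
  sym (trans (cong (ℚ._- seq y n) (x≗y n)) (ℚ.+-inverseʳ (seq y n)))) Null-0)

≈ℝ-refl : ∀ {x} → x ≈ℝ x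
≈ℝ-refl = ≗⇒≈ℝ λ _ → refl

*ℝ-congˡ : ∀ x {y z} → y ≈ℝ z → x *ℝ y ≈ℝ x *ℝ z
*ℝ-congˡ x {y} {z} y≈z = mk≈ℝ (Null-resp-≗ (λ n → eq (seq x n) (seq y n) (seq z n))
  (Null-*ˡ {s = seq x} b {{proj₁ (proj₂ bounded)}} (proj₂ (proj₂ bounded)) (close y≈z)))
  where
  bounded = cauchy⇒bounded {seq x} (isCauchy x)
  b = proj₁ bounded

  eq : ∀ a b c → a ℚ.* (b ℚ.- c) ≡ a ℚ.* b ℚ.- a ℚ.* c
  eq = solve 3 (λ a b c → a :* (b :- c) := a :* b :- a :* c) refl
    where open ℚ-Solver

≈ℝ-trans : ∀ {x y z} → x ≈ℝ y → y ≈ℝ z → x ≈ℝ z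
≈ℝ-trans {x} {y} {z} x≈y y≈z = mk≈ℝ (Null-resp-≗
  (λ n → eq (seq x n) (seq y n) (seq z n)) (Null-+ (close x≈y) (close y≈z)))
  where
  eq : ∀ a b c → (a ℚ.- b) ℚ.+ (b ℚ.- c) ≡ a ℚ.- c
  eq = solve 3 (λ a b c → (a :- b) :+ (b :- c) := a :- c) refl
    where open ℚ-Solver

+ℝ-cong : ∀ {x x′ y y′} → x ≈ℝ x′ → y ≈ℝ y′ → x +ℝ y ≈ℝ x′ +ℝ y′
+ℝ-cong {x} {x′} {y} {y′} x≈ y≈ = mk≈ℝ (Null-resp-≗
  (λ n → eq (seq x n) (seq x′ n) (seq y n) (seq y′ n)) (Null-+ (close x≈) (close y≈)))
  where
  eq : ∀ a a′ b b′ → (a ℚ.- a′) ℚ.+ (b ℚ.- b′) ≡ (a ℚ.+ b) ℚ.- (a′ ℚ.+ b′)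
  eq = solve 4 (λ a a′ b b′ → (a :- a′) :+ (b :- b′) := (a :+ b) :- (a′ :+ b′)) refl
    where open ℚ-Solver

*ℝ-comm : ∀ x y → x *ℝ y ≈ℝ y *ℝ x
*ℝ-comm x y = ≗⇒≈ℝ λ n → ℚ.*-comm (seq x n) (seq y n)

*ℝ-cong : ∀ {x x′ y y′} → x ≈ℝ x′ → y ≈ℝ y′ → x *ℝ y ≈ℝ x′ *ℝ y′
*ℝ-cong {x} {x′} {y} {y′} x≈ y≈ = ≈ℝ-trans (*ℝ-congˡ x y≈)
  (≈ℝ-trans (*ℝ-comm x y′) (≈ℝ-trans (*ℝ-congˡ y′ x≈) (*ℝ-comm y′ x′)))

-- Negation is multiplication by the constant -1, so the product law applies.
-ℝ-cong : ∀ {x y} → x ≈ℝ y → -ℝ x ≈ℝ -ℝ y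
-ℝ-cong {x} {y} x≈y = ≈ℝ-trans (≗⇒≈ℝ λ n → eq (seq x n))
  (≈ℝ-trans (*ℝ-congˡ (fromℚ (ℚ.- 1ℚ)) x≈y) (≗⇒≈ℝ λ n → sym (eq (seq y n))))
  where
  eq : ∀ a → ℚ.- a ≡ (ℚ.- 1ℚ) ℚ.* a
  eq = solve 1 (λ a → :- a := con (ℚ.- 1ℚ) :* a) refl
    where open ℚ-Solver

≈ℝ-sym : ∀ {x y} → x ≈ℝ y → y ≈ℝ x
≈ℝ-sym {x} {y} x≈y = mk≈ℝ λ ε 0<ε → proj₁ (close x≈y ε 0<ε) , λ n N≤n →
  subst (ℚ._< ε) (trans (sym (ℚ.∣-p∣≡∣p∣ (seq x n ℚ.- seq y n)))
                        (cong ∣_∣ (eq (seq x n) (seq y n))))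
    (proj₂ (close x≈y ε 0<ε) n N≤n)
  where
  eq : ∀ a b → ℚ.- (a ℚ.- b) ≡ b ℚ.- a
  eq = solve 2 (λ a b → :- (a :- b) := b :- a) refl
    where open ℚ-Solver

-- If p and q differed, the tolerance ∣p - q∣ would be positive, and the constant distance ∣p - q∣
-- would have to lie strictly below itself. Decidability of equality on ℚ removes the double
-- negation.
fromℚ-injective : ∀ {p q} → fromℚ p ≈ℝ fromℚ q → p ≡ q
fromℚ-injective {p} {q} p≈q = decidable-stable (p ℚ.≟ q) λ p≢q →
  let d     = p ℚ.- q
      0<∣d∣ = ℚ.≰⇒> λ ∣d∣≤0 → p≢q (sub≡0 (ℚ.∣p∣≡0⇒p≡0 d (ℚ.≤-antisym ∣d∣≤0 (ℚ.0≤∣p∣ d))))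
      N , d< = close p≈q ∣ d ∣ 0<∣d∣
  in ℚ.<-irrefl refl (d< N ℕ.≤-refl)
  where
  sub≡0 : p ℚ.- q ≡ 0ℚ → p ≡ q
  sub≡0 eq = trans (split p q) (trans (cong (ℚ._+ q) eq) (ℚ.+-identityˡ q))
    where
    split : ∀ a b → a ≡ (a ℚ.- b) ℚ.+ b
    split = solve 2 (λ a b → a := (a :- b) :+ b) refl
      where open ℚ-Solver

-- Fractions, and the square of a square root

toℚᵘ-/ : ∀ a k → ℚ.toℚᵘ (a / suc k) ℚᵘ.≃ ℚᵘ.mkℚᵘ a k
toℚᵘ-/ a k = ℚ.toℚᵘ-fromℚᵘ (ℚᵘ.mkℚᵘ a k)

/-mono-≤ : ∀ a j b k → a ℕ.* suc k ℕ.≤ b ℕ.* suc j → (+ a) / suc j ℚ.≤ (+ b) / suc k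
/-mono-≤ a j b k a≤b = ℚ.toℚᵘ-cancel-≤ (begin
  ℚ.toℚᵘ ((+ a) / suc j)  ≃⟨ toℚᵘ-/ (+ a) j ⟩
  ℚᵘ.mkℚᵘ (+ a) j         ≤⟨ ℚᵘ.*≤* (subst₂ ℤ._≤_ (ℤ.pos-* a (suc k)) (ℤ.pos-* b (suc j)) (ℤ.+≤+ a≤b)) ⟩
  ℚᵘ.mkℚᵘ (+ b) k         ≃⟨ toℚᵘ-/ (+ b) k ⟨
  ℚ.toℚᵘ ((+ b) / suc k)  ∎)
  where open ℚᵘ.≤-Reasoning

/-+ : ∀ a b k → (+ a) / suc k ℚ.+ (+ b) / suc k ≡ (+ (a ℕ.+ b)) / suc k
/-+ a b k = ℚ.toℚᵘ-injective (begin-equality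
  ℚ.toℚᵘ ((+ a) / suc k ℚ.+ (+ b) / suc k)             ≃⟨ ℚ.toℚᵘ-homo-+ ((+ a) / suc k) ((+ b) / suc k) ⟩
  ℚ.toℚᵘ ((+ a) / suc k) ℚᵘ.+ ℚ.toℚᵘ ((+ b) / suc k)   ≃⟨ ℚᵘ.+-cong (toℚᵘ-/ (+ a) k) (toℚᵘ-/ (+ b) k) ⟩
  ℚᵘ.mkℚᵘ (+ a) k ℚᵘ.+ ℚᵘ.mkℚᵘ (+ b) k                 ≃⟨ ℚᵘ.*≡* (eq (+ a) (+ b) (+ suc k)) ⟩
  ℚᵘ.mkℚᵘ (+ (a ℕ.+ b)) k                              ≃⟨ toℚᵘ-/ (+ (a ℕ.+ b)) k ⟨
  ℚ.toℚᵘ ((+ (a ℕ.+ b)) / suc k)                       ∎)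
  where
  open ℚᵘ.≤-Reasoning
  eq : ∀ a b d → (a ℤ.* d ℤ.+ b ℤ.* d) ℤ.* d ≡ (a ℤ.+ b) ℤ.* (d ℤ.* d)
  eq = solve 3 (λ a b d → (a :* d :+ b :* d) :* d := (a :+ b) :* (d :* d)) refl
    where open ℤ-Solver

/-square : ∀ a k → ((+ a) / suc k) ℚ.* ((+ a) / suc k) ≡ (+ (a ℕ.* a)) / (suc k ℕ.* suc k)
/-square a k = ℚ.toℚᵘ-injective (begin-equality
  ℚ.toℚᵘ (((+ a) / suc k) ℚ.* ((+ a) / suc k))             ≃⟨ ℚ.toℚᵘ-homo-* ((+ a) / suc k) ((+ a) / suc k) ⟩
  ℚ.toℚᵘ ((+ a) / suc k) ℚᵘ.* ℚ.toℚᵘ ((+ a) / suc k)   ≃⟨ ℚᵘ.*-cong (toℚᵘ-/ (+ a) k) (toℚᵘ-/ (+ a) k) ⟩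
  ℚᵘ.mkℚᵘ (+ a) k ℚᵘ.* ℚᵘ.mkℚᵘ (+ a) k                 ≃⟨ ℚᵘ.*≡* (cong (ℤ._* + (suc k ℕ.* suc k)) (sym (ℤ.pos-* a a))) ⟩
  -- `mkℚᵘ` stores the denominator minus one, and `k + k * suc k` is the predecessor of (k+1)².
  ℚᵘ.mkℚᵘ (+ (a ℕ.* a)) (k ℕ.+ k ℕ.* suc k)            ≃⟨ toℚᵘ-/ (+ (a ℕ.* a)) (k ℕ.+ k ℕ.* suc k) ⟨
  ℚ.toℚᵘ ((+ (a ℕ.* a)) / (suc k ℕ.* suc k))           ∎)
  where open ℚᵘ.≤-Reasoning

/suc-small : ∀ m ε → 0ℚ ℚ.< ε → ∃ λ N → ∀ k → N ℕ.≤ k → (+ m) / suc k ℚ.< ε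
/suc-small m (mkℚ (+ zero)     q c) (*<* (ℤ.+<+ ()))
/suc-small m (mkℚ ℤ.-[1+ _ ]   q c) (*<* ())
-- Here ε = (p+1)/(q+1). From m(q+1) ≤ k follows m(q+1) < k+1 ≤ (p+1)(k+1), the cross-multiplied
-- claim.
/suc-small m (mkℚ (+ suc p)    q c) _ = m ℕ.* suc q , λ k N≤k → ℚ.toℚᵘ-cancel-< (begin-strict
  ℚ.toℚᵘ ((+ m) / suc k)  ≃⟨ toℚᵘ-/ (+ m) k ⟩
  ℚᵘ.mkℚᵘ (+ m) k         <⟨ ℚᵘ.*<* (subst₂ ℤ._<_ (ℤ.pos-* m (suc q)) (ℤ.pos-* (suc p) (suc k))
                               (ℤ.+<+ (ℕ.<-≤-trans (ℕ.s≤s N≤k) (ℕ.m≤n*m (suc k) (suc p))))) ⟩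
  ℚᵘ.mkℚᵘ (+ suc p) q     ∎)
  where open ℚᵘ.≤-Reasoning

∣-∣-≤ : ∀ {p q e} → p ℚ.≤ q ℚ.+ e → q ℚ.≤ p ℚ.+ e → ∣ p ℚ.- q ∣ ℚ.≤ e
∣-∣-≤ {p} {q} {e} p≤ q≤ =
  [ (λ eq → subst (ℚ._≤ e) (sym eq) (sub-≤ p≤))
  , (λ eq → subst (ℚ._≤ e) (sym (trans eq (flip-sub p q))) (sub-≤ q≤))
  ]′ (ℚ.∣p∣≡p∨∣p∣≡-p (p ℚ.- q))
  where
  cancel : ∀ b c → (b ℚ.+ c) ℚ.- b ≡ c
  cancel = solve 2 (λ b c → (b :+ c) :- b := c) refl
    where open ℚ-Solver

  flip-sub : ∀ a b → ℚ.- (a ℚ.- b) ≡ b ℚ.- a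
  flip-sub = solve 2 (λ a b → :- (a :- b) := b :- a) refl
    where open ℚ-Solver

  sub-≤ : ∀ {a b} → a ℚ.≤ b ℚ.+ e → a ℚ.- b ℚ.≤ e
  sub-≤ {a} {b} a≤ = subst (a ℚ.- b ℚ.≤_) (cancel b e) (ℚ.+-monoˡ-≤ (ℚ.- b) a≤)

-- A crude bound from n ≤ n². Being linear in k, it suffices for an error that vanishes after
-- division by k².
isqrt-square-≤ : ∀ n k → isqrt (n ℕ.* (k ℕ.* k)) ℕ.≤ n ℕ.* k
isqrt-square-≤ n k = ℕ.≮⇒≥ λ nk<a → ℕ.<⇒≱ (ℕ.*-mono-< nk<a nk<a) (begin
  a ℕ.* a                  ≤⟨ isqrt-lower (n ℕ.* (k ℕ.* k)) ⟩
  n ℕ.* (k ℕ.* k)          ≤⟨ ℕ.*-monoˡ-≤ (k ℕ.* k) (n≤n*n n) ⟩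
  n ℕ.* n ℕ.* (k ℕ.* k)    ≡⟨ square n k ⟩
  (n ℕ.* k) ℕ.* (n ℕ.* k)  ∎)
  where
  open ℕ.≤-Reasoning
  a = isqrt (n ℕ.* (k ℕ.* k))

  n≤n*n : ∀ n → n ℕ.≤ n ℕ.* n
  n≤n*n zero    = ℕ.z≤n
  n≤n*n (suc n) = ℕ.m≤m*n (suc n) (suc n)

  square : ∀ n k → n ℕ.* n ℕ.* (k ℕ.* k) ≡ (n ℕ.* k) ℕ.* (n ℕ.* k)
  square = solve 2 (λ n k → n :* n :* (k :* k) := (n :* k) :* (n :* k)) refl
    where open ℕ-Solver

-- The strict bound nk² < (a+1)² gives nk² ≤ a² + 2a, and a ≤ nk makes the excess at most linear in
-- k.
isqrt-error : ∀ n k → let a = isqrt (n ℕ.* (k ℕ.* k)) in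
  n ℕ.* (k ℕ.* k) ℕ.≤ a ℕ.* a ℕ.+ suc (2 ℕ.* n) ℕ.* k
isqrt-error n k = begin
  n ℕ.* (k ℕ.* k)                           ≤⟨ ℕ.≤-pred (ℕ.≤-trans (isqrt-upper (n ℕ.* (k ℕ.* k)))
                                                 (ℕ.≤-reflexive (expand a))) ⟩
  a ℕ.* a ℕ.+ 2 ℕ.* a                       ≤⟨ ℕ.+-monoʳ-≤ (a ℕ.* a) (ℕ.*-monoʳ-≤ 2 (isqrt-square-≤ n k)) ⟩
  a ℕ.* a ℕ.+ 2 ℕ.* (n ℕ.* k)               ≡⟨ cong (a ℕ.* a ℕ.+_) (ℕ.*-assoc 2 n k) ⟨
  a ℕ.* a ℕ.+ (2 ℕ.* n) ℕ.* k               ≤⟨ ℕ.+-monoʳ-≤ (a ℕ.* a) (ℕ.m≤n+m _ k) ⟩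
  a ℕ.* a ℕ.+ suc (2 ℕ.* n) ℕ.* k           ∎
  where
  open ℕ.≤-Reasoning
  a = isqrt (n ℕ.* (k ℕ.* k))

  expand : ∀ a → suc a ℕ.* suc a ≡ suc (a ℕ.* a ℕ.+ 2 ℕ.* a)
  expand = solve 1 (λ a → (con 1 :+ a) :* (con 1 :+ a) := con 1 :+ (a :* a :+ con 2 :* a)) refl
    where open ℕ-Solver

-- Over the common denominator (k+1)² the numerators differ by at most (2n+1)(k+1). One factor k+1
-- cancels, leaving an error of order 1/(k+1).
√-square-error : ∀ n k →
  ∣ √-seq n k ℚ.* √-seq n k ℚ.- (+ n) / 1 ∣ ℚ.≤ (+ suc (2 ℕ.* n)) / suc k
√-square-error n k = begin
  ∣ √-seq n k ℚ.* √-seq n k ℚ.- (+ n) / 1 ∣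
    ≡⟨ cong₂ (λ p q → ∣ p ℚ.- q ∣) (/-square a k) n≡ ⟩
  ∣ (+ (a ℕ.* a)) / D ℚ.- (+ (n ℕ.* D)) / D ∣
    ≤⟨ ∣-∣-≤ (mono (ℕ.≤-trans (isqrt-lower (n ℕ.* D)) (ℕ.m≤m+n (n ℕ.* D) (M ℕ.* k₊)))) (mono upper) ⟩
  (+ (M ℕ.* k₊)) / D
    ≤⟨ /-mono-≤ (M ℕ.* k₊) _ M k (ℕ.≤-reflexive (ℕ.*-assoc M k₊ k₊)) ⟩
  (+ M) / k₊
    ∎
  where
  open ℚ.≤-Reasoning
  k₊ = suc k
  D = k₊ ℕ.* k₊
  M = suc (2 ℕ.* n)
  a = isqrt (n ℕ.* D)

  n≡ : (+ n) / 1 ≡ (+ (n ℕ.* D)) / D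
  n≡ = ℚ.≤-antisym
    (/-mono-≤ n 0 (n ℕ.* D) _ (ℕ.≤-reflexive (sym (ℕ.*-identityʳ (n ℕ.* D)))))
    (/-mono-≤ (n ℕ.* D) _ n 0 (ℕ.≤-reflexive (ℕ.*-identityʳ (n ℕ.* D))))

  mono : ∀ {b c} → b ℕ.≤ c ℕ.+ M ℕ.* k₊ → (+ b) / D ℚ.≤ (+ c) / D ℚ.+ (+ (M ℕ.* k₊)) / D
  mono {b} {c} b≤ = subst ((+ b) / D ℚ.≤_) (sym (/-+ c (M ℕ.* k₊) _))
    (/-mono-≤ b _ (c ℕ.+ M ℕ.* k₊) _ (ℕ.*-monoˡ-≤ D b≤))

  upper : n ℕ.* D ℕ.≤ a ℕ.* a ℕ.+ M ℕ.* k₊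
  upper = isqrt-error n k₊

√-square : ∀ n → √ n *ℝ √ n ≈ℝ fromℚ ((+ n) / 1)
√-square n = mk≈ℝ λ ε 0<ε →
  let N , small = /suc-small (suc (2 ℕ.* n)) ε 0<ε
  in N , λ k N≤k → ℚ.≤-<-trans (√-square-error n k) (small k N≤k)

-- The complex numbers as a commutative semiring

conj-cong : ∀ {z w} → z ≈ w → conj z ≈ conj w
conj-cong (mk≈ℂ re≈ im≈) = mk≈ℂ re≈ (-ℝ-cong im≈)

≗⇒≈ : ∀ {z w} → seq (re z) ≗ seq (re w) → seq (im z) ≗ seq (im w) → z ≈ w
≗⇒≈ re≗ im≗ = mk≈ℂ (≗⇒≈ℝ re≗) (≗⇒≈ℝ im≗)

-- This structure gives access to the generic laws of finite sums: distributivity and exchange of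
-- summations. The ring laws are polynomial identities over ℚ in the real and imaginary parts at
-- each index.
ℂ-commutativeSemiring : CommutativeSemiring 0ℓ 0ℓ
ℂ-commutativeSemiring = record
  { Carrier = ℂ ; _≈_ = _≈_ ; _+_ = _+_ ; _*_ = _*_ ; 0# = 0ℂ ; 1# = 1ℂ
  ; isCommutativeSemiring = isCommutativeSemiringˡ record
    { +-isCommutativeMonoid = record
      { isMonoid = record
        { isSemigroup = record
          { isMagma = record
            { isEquivalence = isEquivalence
            ; ∙-cong        = λ (mk≈ℂ a b) (mk≈ℂ c d) → mk≈ℂ (+ℝ-cong a c) (+ℝ-cong b d)
            }
          ; assoc = λ z w v → ≗⇒≈
              (λ n → ℚ.+-assoc (x z n) (x w n) (x v n))
              (λ n → ℚ.+-assoc (y z n) (y w n) (y v n))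
          }
        ; identity =
            (λ z → ≗⇒≈ (λ n → ℚ.+-identityˡ (x z n)) (λ n → ℚ.+-identityˡ (y z n)))
          , (λ z → ≗⇒≈ (λ n → ℚ.+-identityʳ (x z n)) (λ n → ℚ.+-identityʳ (y z n)))
        }
      ; comm = λ z w → ≗⇒≈ (λ n → ℚ.+-comm (x z n) (x w n)) (λ n → ℚ.+-comm (y z n) (y w n))
      }
    ; *-isCommutativeMonoid = record
      { isMonoid = record
        { isSemigroup = record
          { isMagma = record
            { isEquivalence = isEquivalence
            ; ∙-cong        = λ (mk≈ℂ a b) (mk≈ℂ c d) → mk≈ℂ
                (+ℝ-cong (*ℝ-cong a c) (-ℝ-cong (*ℝ-cong b d)))
                (+ℝ-cong (*ℝ-cong a d) (*ℝ-cong b c))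
            }
          ; assoc = λ z w v → ≗⇒≈
              (λ n → *-assoc-re (x z n) (y z n) (x w n) (y w n) (x v n) (y v n))
              (λ n → *-assoc-im (x z n) (y z n) (x w n) (y w n) (x v n) (y v n))
          }
        ; identity =
            (λ z → ≗⇒≈ (λ n → *-identityˡ-re (x z n) (y z n)) (λ n → *-identityˡ-im (x z n) (y z n)))
          , (λ z → ≗⇒≈ (λ n → *-identityʳ-re (x z n) (y z n)) (λ n → *-identityʳ-im (x z n) (y z n)))
        }
      ; comm = λ z w → ≗⇒≈
          (λ n → *-comm-re (x z n) (y z n) (x w n) (y w n))
          (λ n → *-comm-im (x z n) (y z n) (x w n) (y w n))
      }
    ; distribʳ = λ z w v → ≗⇒≈
        (λ n → distribʳ-re (x z n) (y z n) (x w n) (y w n) (x v n) (y v n))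
        (λ n → distribʳ-im (x z n) (y z n) (x w n) (y w n) (x v n) (y v n))
    ; zeroˡ = λ z → ≗⇒≈ (λ n → zeroˡ-re (x z n) (y z n)) (λ n → zeroˡ-im (x z n) (y z n))
    }
  }
  where
  open ℚ-Solver
  x y : ℂ → ℕ → ℚ
  x z = seq (re z)
  y z = seq (im z)

  isEquivalence : IsEquivalence _≈_
  isEquivalence = record
    { refl  = mk≈ℂ ≈ℝ-refl ≈ℝ-refl
    ; sym   = λ (mk≈ℂ p q) → mk≈ℂ (≈ℝ-sym p) (≈ℝ-sym q)
    ; trans = λ (mk≈ℂ p q) (mk≈ℂ r s) → mk≈ℂ (≈ℝ-trans p r) (≈ℝ-trans q s)
    }

  re* im* : ∀ {n} (a b c d : Polynomial n) → Polynomial n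
  re* a b c d = a :* c :+ :- (b :* d)
  im* a b c d = a :* d :+ b :* c

  *-assoc-re = solve 6 (λ a b c d e f →
    re* (re* a b c d) (im* a b c d) e f := re* a b (re* c d e f) (im* c d e f)) refl
  *-assoc-im = solve 6 (λ a b c d e f →
    im* (re* a b c d) (im* a b c d) e f := im* a b (re* c d e f) (im* c d e f)) refl
  *-identityˡ-re = solve 2 (λ a b → re* (con 1ℚ) (con 0ℚ) a b := a) refl
  *-identityˡ-im = solve 2 (λ a b → im* (con 1ℚ) (con 0ℚ) a b := b) refl
  *-identityʳ-re = solve 2 (λ a b → re* a b (con 1ℚ) (con 0ℚ) := a) refl
  *-identityʳ-im = solve 2 (λ a b → im* a b (con 1ℚ) (con 0ℚ) := b) refl
  *-comm-re = solve 4 (λ a b c d → re* a b c d := re* c d a b) refl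
  *-comm-im = solve 4 (λ a b c d → im* a b c d := im* c d a b) refl
  distribʳ-re = solve 6 (λ a b c d e f →
    re* (c :+ e) (d :+ f) a b := re* c d a b :+ re* e f a b) refl
  distribʳ-im = solve 6 (λ a b c d e f →
    im* (c :+ e) (d :+ f) a b := im* c d a b :+ im* e f a b) refl
  zeroˡ-re = solve 2 (λ a b → re* (con 0ℚ) (con 0ℚ) a b := con 0ℚ) refl
  zeroˡ-im = solve 2 (λ a b → im* (con 0ℚ) (con 0ℚ) a b := con 0ℚ) refl

module CS = CommutativeSemiring ℂ-commutativeSemiring
open SemiringSum CS.semiring
  using (sum-cong-≋; sum-replicate-zero; ∑-comm; *-distribˡ-sum; *-distribʳ-sum)
open SetoidReasoning CS.setoid

*-swapˡ : ∀ z w v → z * (w * v) ≈ w * (z * v)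
*-swapˡ z w v = begin
  z * (w * v)  ≈⟨ CS.*-assoc z w v ⟨
  (z * w) * v  ≈⟨ CS.*-congʳ (CS.*-comm z w) ⟩
  (w * z) * v  ≈⟨ CS.*-assoc w z v ⟩
  w * (z * v)  ∎

-- Scalar matrices, and orthonormal bases from unitary matrices

diagonal : ∀ {A : Set} → A → A → ∀ {n} → Fin n → Fin n → A
diagonal o d zero    zero    = d
diagonal o d zero    (suc j) = o
diagonal o d (suc i) zero    = o
diagonal o d (suc i) (suc j) = diagonal o d i j

diagonal-≡ : ∀ {A : Set} (o d : A) {n} (i : Fin n) → diagonal o d i i ≡ d
diagonal-≡ o d zero    = refl
diagonal-≡ o d (suc i) = diagonal-≡ o d i

diagonal-≢ : ∀ {A : Set} (o d : A) {n} (i j : Fin n) → i ≢ j → diagonal o d i j ≡ o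
diagonal-≢ o d zero    zero    i≢j = contradiction refl i≢j
diagonal-≢ o d zero    (suc j) i≢j = refl
diagonal-≢ o d (suc i) zero    i≢j = refl
diagonal-≢ o d (suc i) (suc j) i≢j = diagonal-≢ o d i j λ i≡j → i≢j (cong suc i≡j)

δ : ∀ {n} → Fin n → Fin n → ℂ
δ = diagonal 0ℂ 1ℂ

sum-zeroˡ : ∀ {n} (v : Vector ℂ n) → sum (λ j → 0ℂ * v j) ≈ 0ℂ
sum-zeroˡ {n} v = CS.trans (sum-cong-≋ λ j → CS.zeroˡ (v j)) (sum-replicate-zero n)

sum-δ : ∀ {n} (i : Fin n) (v : Vector ℂ n) → sum (λ j → δ i j * v j) ≈ v i
sum-δ zero v = begin
  1ℂ * v zero + sum (λ j → 0ℂ * v (suc j))  ≈⟨ CS.+-cong (CS.*-identityˡ (v zero)) (sum-zeroˡ (λ j → v (suc j))) ⟩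
  v zero + 0ℂ                               ≈⟨ CS.+-identityʳ (v zero) ⟩
  v zero                                    ∎
sum-δ (suc i) v = begin
  0ℂ * v zero + sum (λ j → δ i j * v (suc j))  ≈⟨ CS.+-cong (CS.zeroˡ (v zero)) (sum-δ i (λ j → v (suc j))) ⟩
  0ℂ + v (suc i)                               ≈⟨ CS.+-identityˡ (v (suc i)) ⟩
  v (suc i)                                    ∎

-- Associativity of the product row vector, matrix, column vector. Both the spanning and the
-- independence argument regroup such a triple product.
sum-*-assoc : ∀ {m n} (x : Vector ℂ m) (y : Fin m → Fin n → ℂ) (z : Vector ℂ n) →
  sum (λ i → x i * sum (λ j → y i j * z j)) ≈ sum (λ j → sum (λ i → x i * y i j) * z j)
sum-*-assoc x y z = begin
  sum (λ i → x i * sum (λ j → y i j * z j))    ≈⟨ sum-cong-≋ (λ i → *-distribˡ-sum (x i) (λ j → y i j * z j)) ⟩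
  sum (λ i → sum (λ j → x i * (y i j * z j)))  ≈⟨ ∑-comm (λ i j → x i * (y i j * z j)) ⟩
  sum (λ j → sum (λ i → x i * (y i j * z j)))  ≈⟨ sum-cong-≋ (λ j → sum-cong-≋ λ i → CS.*-assoc (x i) (y i j) (z j)) ⟨
  sum (λ j → sum (λ i → (x i * y i j) * z j))  ≈⟨ sum-cong-≋ (λ j → *-distribʳ-sum (z j) (λ i → x i * y i j)) ⟨
  sum (λ j → sum (λ i → x i * y i j) * z j)    ∎

-- b* b = I gives independence and b b* = I gives spanning, so no rank argument is needed.

unitary⇒orthonormalBasis : ∀ {n} (b : Vector (Vector ℂ n) n) →
  (∀ i j → ⟨ b i , b j ⟩ ≈ δ i j) →
  (∀ r s → sum (λ i → b i r * conj (b i s)) ≈ δ r s) →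
  IsOrthonormalBasis b
unitary⇒orthonormalBasis b gram dual = record
  { unit        = λ i → CS.trans (gram i i) (CS.reflexive (diagonal-≡ 0ℂ 1ℂ i))
  ; orthogonal  = λ i j i≢j → CS.trans (gram i j) (CS.reflexive (diagonal-≢ 0ℂ 1ℂ i j i≢j))
  -- The coefficients are the Fourier coefficients of `v`, and the expansion is b b* v = v.
  ; spanning    = λ v → (λ i → ⟨ b i , v ⟩) , λ r → begin
      sum (λ i → ⟨ b i , v ⟩ * b i r)
        ≈⟨ sum-cong-≋ (λ i → CS.*-comm ⟨ b i , v ⟩ (b i r)) ⟩
      sum (λ i → b i r * ⟨ b i , v ⟩)
        ≈⟨ sum-*-assoc (λ i → b i r) (λ i s → conj (b i s)) v ⟩
      sum (λ s → sum (λ i → b i r * conj (b i s)) * v s)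
        ≈⟨ sum-cong-≋ (λ s → CS.*-congʳ (dual r s)) ⟩
      sum (λ s → δ r s * v s)
        ≈⟨ sum-δ r v ⟩
      v r ∎
  -- The coefficient `c i` is recovered as the inner product of `b i` with the combination, which
  -- vanishes.
  ; independent = λ c zero-combination i → begin
      c i
        ≈⟨ sum-δ i c ⟨
      sum (λ j → δ i j * c j)
        ≈⟨ sum-cong-≋ (λ j → CS.*-congʳ (gram i j)) ⟨
      sum (λ j → ⟨ b i , b j ⟩ * c j)
        ≈⟨ sum-*-assoc (λ r → conj (b i r)) (λ r j → b j r) c ⟨
      sum (λ r → conj (b i r) * sum (λ j → b j r * c j))
        ≈⟨ sum-cong-≋ (λ r → CS.*-congˡ {conj (b i r)} (sum-cong-≋ λ j → CS.*-comm (b j r) (c j))) ⟩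
      sum (λ r → conj (b i r) * linearCombination c b r)
        ≈⟨ sum-cong-≋ (λ r → CS.trans (CS.*-congˡ {conj (b i r)} (zero-combination r)) (CS.*-comm (conj (b i r)) 0ℂ)) ⟩
      sum (λ r → 0ℂ * conj (b i r))
        ≈⟨ sum-zeroˡ (λ r → conj (b i r)) ⟩
      0ℂ ∎
  }

-- The field ℚ(√-3) and its embedding in ℂ

3ℚ : ℚ
3ℚ = (+ 3) / 1

-- (a , b) stands for a + b √-3.

ℚ√-3 : RawRing 0ℓ 0ℓ
ℚ√-3 = record
  { Carrier = ℚ × ℚ
  ; _≈_     = _≡_
  ; _+_     = λ (a , b) (c , d) → a ℚ.+ c , b ℚ.+ d
  ; _*_     = λ (a , b) (c , d) → a ℚ.* c ℚ.- 3ℚ ℚ.* (b ℚ.* d) , a ℚ.* d ℚ.+ b ℚ.* c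
  ; -_      = λ (a , b) → ℚ.- a , ℚ.- b
  ; 0#      = 0ℚ , 0ℚ
  ; 1#      = 1ℚ , 0ℚ
  }

module E where
  open RawRing ℚ√-3 public using (Carrier; _+_; _*_; 0#; 1#)
  open RawSemiringOps (RawRing.rawSemiring ℚ√-3) public using (_^_; sum)

  conjugate : Carrier → Carrier
  conjugate (a , b) = a , ℚ.- b

  6# : Carrier
  6# = (+ 6) / 1 , 0ℚ

  -- The primitive sixth root of unity e^{πi/3}, not a cube root: its image under `ι` is `η` by
  -- definition.
  ω : Carrier
  ω = ½ , ½

  _≟_ : DecidableEquality Carrier
  _≟_ = ≡-dec ℚ._≟_ ℚ._≟_

-- Equality of pairs of rationals is decidable, so identities can be checked by evaluation on the
-- left and carried over to Cauchy complex numbers.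
ι : E.Carrier → ℂ
ι (a , b) = fromℚ a +i (fromℚ b *ℝ √ 3)

ι-0 : ι E.0# ≈ 0ℂ
ι-0 = ≗⇒≈ (λ _ → refl) (λ n → ℚ.*-zeroˡ (√-seq 3 n))

ι-1 : ι E.1# ≈ 1ℂ
ι-1 = ≗⇒≈ (λ _ → refl) (λ n → ℚ.*-zeroˡ (√-seq 3 n))

ι-+ : ∀ x y → ι (x E.+ y) ≈ ι x + ι y
ι-+ (a , b) (c , d) = ≗⇒≈ (λ _ → refl) (λ n → ℚ.*-distribʳ-+ (√-seq 3 n) b d)

-- The real part needs `√-square`, as the approximations of √3 square to 3 only in the limit. The
-- imaginary part is linear in √3 and agrees termwise.
ι-* : ∀ x y → ι (x E.* y) ≈ ι x * ι y
ι-* (a , b) (c , d) = mk≈ℂ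
  (≈ℝ-trans (≗⇒≈ℝ λ n → re₁ a b c d)
  (≈ℝ-trans (+ℝ-cong (≈ℝ-refl {fromℚ (a ℚ.* c)})
              (-ℝ-cong (*ℝ-congˡ (fromℚ (b ℚ.* d)) (≈ℝ-sym (√-square 3)))))
            (≗⇒≈ℝ λ n → re₂ a b c d (√-seq 3 n))))
  (≗⇒≈ℝ λ n → im₁ a b c d (√-seq 3 n))
  where
  open ℚ-Solver
  re₁ : ∀ a b c d → a ℚ.* c ℚ.- 3ℚ ℚ.* (b ℚ.* d) ≡ a ℚ.* c ℚ.+ ℚ.- (b ℚ.* d ℚ.* 3ℚ)
  re₁ = solve 4 (λ a b c d → a :* c :- con 3ℚ :* (b :* d) := a :* c :+ :- (b :* d :* con 3ℚ)) refl

  re₂ : ∀ a b c d s → a ℚ.* c ℚ.+ ℚ.- (b ℚ.* d ℚ.* (s ℚ.* s)) ≡ a ℚ.* c ℚ.+ ℚ.- ((b ℚ.* s) ℚ.* (d ℚ.* s))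
  re₂ = solve 5 (λ a b c d s → a :* c :+ :- (b :* d :* (s :* s)) := a :* c :+ :- ((b :* s) :* (d :* s))) refl

  im₁ : ∀ a b c d s → (a ℚ.* d ℚ.+ b ℚ.* c) ℚ.* s ≡ a ℚ.* (d ℚ.* s) ℚ.+ (b ℚ.* s) ℚ.* c
  im₁ = solve 5 (λ a b c d s → (a :* d :+ b :* c) :* s := a :* (d :* s) :+ (b :* s) :* c) refl

ι-conj : ∀ x → ι (E.conjugate x) ≈ conj (ι x)
ι-conj (a , b) = ≗⇒≈ (λ _ → refl) (λ n → sym (ℚ.neg-distribˡ-* b (√-seq 3 n)))

ι-^ : ∀ x k → ι (x E.^ k) ≈ ι x ^ k
ι-^ x zero    = ι-1
ι-^ x (suc k) = CS.trans (ι-* x (x E.^ k)) (CS.*-congˡ {ι x} (ι-^ x k))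

ι-sum : ∀ {n} (x : Fin n → E.Carrier) → ι (E.sum x) ≈ sum (λ i → ι (x i))
ι-sum {zero}  x = ι-0
ι-sum {suc n} x = CS.trans (ι-+ (x zero) (E.sum (λ i → x (suc i))))
  (CS.+-congˡ {ι (x zero)} (ι-sum (λ i → x (suc i))))

-- The real part yields the first component. Multiplying the imaginary part by √3/3, the inverse of
-- √3, recovers the second.
ι-injective : ∀ {x y} → ι x ≈ ι y → x ≡ y
ι-injective {a , b} {c , d} (mk≈ℂ re≈ im≈) = cong₂ _,_ (fromℚ-injective re≈)
  (fromℚ-injective (≈ℝ-trans (divide b)
    (≈ℝ-trans (*ℝ-cong im≈ (≈ℝ-refl {√ 3 *ℝ fromℚ ⅓})) (≈ℝ-sym (divide d)))))
  where
  open ℚ-Solver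
  ⅓ = (+ 1) / 3

  eq₁ : ∀ q → q ≡ q ℚ.* ⅓ ℚ.* 3ℚ
  eq₁ = solve 1 (λ q → q := q :* con ⅓ :* con 3ℚ) refl

  eq₂ : ∀ q s → q ℚ.* ⅓ ℚ.* (s ℚ.* s) ≡ (q ℚ.* s) ℚ.* (s ℚ.* ⅓)
  eq₂ = solve 2 (λ q s → q :* con ⅓ :* (s :* s) := (q :* s) :* (s :* con ⅓)) refl

  divide : ∀ q → fromℚ q ≈ℝ (fromℚ q *ℝ √ 3) *ℝ (√ 3 *ℝ fromℚ ⅓)
  divide q = ≈ℝ-trans (≗⇒≈ℝ λ _ → eq₁ q)
    (≈ℝ-trans (*ℝ-congˡ (fromℚ (q ℚ.* ⅓)) (≈ℝ-sym (√-square 3)))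
              (≗⇒≈ℝ λ n → eq₂ q (√-seq 3 n)))

-- The factor 1/√6, and rescaled Hadamard matrices

conj-1/√6 : conj (fromℝ 1/√6) ≈ fromℝ 1/√6
conj-1/√6 = ≗⇒≈ (λ _ → refl) (λ _ → refl)

1/√6-square : (fromℝ 1/√6 * fromℝ 1/√6) * ι E.6# ≈ 1ℂ
1/√6-square = mk≈ℂ
  (≈ℝ-trans (≗⇒≈ℝ λ n → re₁ (√-seq 6 n) (√-seq 3 n))
  (≈ℝ-trans (*ℝ-congˡ (fromℚ ((+ 1) / 6)) (√-square 6)) (≗⇒≈ℝ λ _ → refl)))
  (≗⇒≈ℝ λ n → im₁ (√-seq 6 n) (√-seq 3 n))
  where
  open ℚ-Solver
  c₀ : ∀ {n} → Polynomial n
  c₀ = con 0ℚ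
  c₆ : ∀ {n} → Polynomial n
  c₆ = con ((+ 6) / 1)
  u : ∀ {n} → Polynomial n → Polynomial n
  u s = con ((+ 1) / 6) :* s

  -- Here `s` and `t` approximate √6 and √3. The latter enters through the imaginary part 0·√3 of
  -- `ι E.6#`.
  re₁ = solve 2 (λ s t → (u s :* u s :+ :- (c₀ :* c₀)) :* c₆ :+ :- ((u s :* c₀ :+ c₀ :* u s) :* (c₀ :* t))
                       := con ((+ 1) / 6) :* (s :* s)) refl
  im₁ = solve 2 (λ s t → (u s :* u s :+ :- (c₀ :* c₀)) :* (c₀ :* t) :+ (u s :* c₀ :+ c₀ :* u s) :* c₆
                       := c₀) refl

*-interchange : ∀ a b c d → (a * b) * (c * d) ≈ (a * c) * (b * d)
*-interchange a b c d = begin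
  (a * b) * (c * d)  ≈⟨ CS.*-assoc a b (c * d) ⟩
  a * (b * (c * d))  ≈⟨ CS.*-congˡ {a} (*-swapˡ b c d) ⟩
  a * (c * (b * d))  ≈⟨ CS.*-assoc a c (b * d) ⟨
  (a * c) * (b * d)  ∎

conj-* : ∀ z z′ → conj (z * z′) ≈ conj z * conj z′
conj-* z z′ = ≗⇒≈
  (λ n → eq-re (seq (re z) n) (seq (im z) n) (seq (re z′) n) (seq (im z′) n))
  (λ n → eq-im (seq (re z) n) (seq (im z) n) (seq (re z′) n) (seq (im z′) n))
  where
  open ℚ-Solver
  eq-re = solve 4 (λ a b c d → a :* c :+ :- (b :* d) := a :* c :+ :- ((:- b) :* (:- d))) refl
  eq-im = solve 4 (λ a b c d → :- (a :* d :+ b :* c) := a :* (:- d) :+ (:- b) :* c) refl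

-- The exact, unnormalised form of the two hypotheses of `unitary⇒orthonormalBasis`, with 6 times
-- the identity in place of the identity.
IsHadamard : (Fin 6 → Fin 6 → E.Carrier) → Set
IsHadamard x = (∀ i j → E.sum (λ r → E.conjugate (x i r) E.* x j r) ≡ diagonal E.0# E.6# i j)
             × (∀ r s → E.sum (λ i → x i r E.* E.conjugate (x i s)) ≡ diagonal E.0# E.6# r s)

module _ (w : ℂ) (conj-w : conj w ≈ w) (w*w*6≈1 : (w * w) * ι E.6# ≈ 1ℂ) where

  -- Since 6w² = 1, the inverse of `w` is 6w.
  w-cancelˡ : ∀ {z z′} → w * z ≈ w * z′ → z ≈ z′
  w-cancelˡ {z} {z′} wz≈wz′ = CS.trans (expand z) (CS.trans (CS.*-congˡ {w * ι E.6#} wz≈wz′) (CS.sym (expand z′)))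
    where
    expand : ∀ z → z ≈ (w * ι E.6#) * (w * z)
    expand z = begin
      z                          ≈⟨ CS.*-identityˡ z ⟨
      1ℂ * z                     ≈⟨ CS.*-congʳ w*w*6≈1 ⟨
      ((w * w) * ι E.6#) * z     ≈⟨ CS.*-congʳ (CS.*-assoc w w (ι E.6#)) ⟩
      (w * (w * ι E.6#)) * z     ≈⟨ CS.*-congʳ (CS.*-comm w (w * ι E.6#)) ⟩
      ((w * ι E.6#) * w) * z     ≈⟨ CS.*-assoc (w * ι E.6#) w z ⟩
      (w * ι E.6#) * (w * z)     ∎

  w*w*diagonal : ∀ {n} (i j : Fin n) → (w * w) * ι (diagonal E.0# E.6# i j) ≈ δ i j
  w*w*diagonal zero    zero    = w*w*6≈1
  w*w*diagonal zero    (suc j) = CS.trans (CS.*-congˡ {w * w} ι-0) (CS.zeroʳ (w * w))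
  w*w*diagonal (suc i) zero    = CS.trans (CS.*-congˡ {w * w} ι-0) (CS.zeroʳ (w * w))
  w*w*diagonal (suc i) (suc j) = w*w*diagonal i j

  conj-w* : ∀ {z} x → z ≈ w * ι x → conj z ≈ w * ι (E.conjugate x)
  conj-w* {z} x z≈ = begin
    conj z                ≈⟨ conj-cong z≈ ⟩
    conj (w * ι x)        ≈⟨ conj-* w (ι x) ⟩
    conj w * conj (ι x)   ≈⟨ CS.*-cong conj-w (CS.sym (ι-conj x)) ⟩
    w * ι (E.conjugate x)      ∎

  -- Each factor contributes one `w`, so w² comes out of the sum and what remains is a sum in
  -- ℚ(√-3).
  sum-w*w : ∀ {n} (f g : Vector ℂ n) (x y : Fin n → E.Carrier) →
    (∀ i → f i ≈ w * ι (x i)) → (∀ i → g i ≈ w * ι (y i)) →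
    sum (λ i → f i * g i) ≈ (w * w) * ι (E.sum λ i → x i E.* y i)
  sum-w*w f g x y f≈ g≈ = begin
    sum (λ i → f i * g i)                      ≈⟨ sum-cong-≋ (λ i → CS.*-cong (f≈ i) (g≈ i)) ⟩
    sum (λ i → (w * ι (x i)) * (w * ι (y i)))  ≈⟨ sum-cong-≋ (λ i → *-interchange w (ι (x i)) w (ι (y i))) ⟩
    sum (λ i → (w * w) * (ι (x i) * ι (y i)))  ≈⟨ *-distribˡ-sum (w * w) (λ i → ι (x i) * ι (y i)) ⟨
    (w * w) * sum (λ i → ι (x i) * ι (y i))    ≈⟨ CS.*-congˡ {w * w} (sum-cong-≋ λ i → ι-* (x i) (y i)) ⟨
    (w * w) * sum (λ i → ι (x i E.* y i))      ≈⟨ CS.*-congˡ {w * w} (ι-sum λ i → x i E.* y i) ⟨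
    (w * w) * ι (E.sum λ i → x i E.* y i)      ∎

  hadamard⇒orthonormalBasis : (b : Vector (Vector ℂ 6) 6) (x : Fin 6 → Fin 6 → E.Carrier) →
    (∀ i r → b i r ≈ w * ι (x i r)) → IsHadamard x → IsOrthonormalBasis b
  hadamard⇒orthonormalBasis b x b≈ (gram , dual) = unitary⇒orthonormalBasis b
    (λ i j → CS.trans
      (sum-w*w (λ r → conj (b i r)) (b j) (λ r → E.conjugate (x i r)) (x j)
        (λ r → conj-w* (x i r) (b≈ i r)) (b≈ j))
      (scaled i j (gram i j)))
    (λ r s → CS.trans
      (sum-w*w (λ i → b i r) (λ i → conj (b i s)) (λ i → x i r) (λ i → E.conjugate (x i s))
        (λ i → b≈ i r) (λ i → conj-w* (x i s) (b≈ i s)))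
      (scaled r s (dual r s)))
    where
    scaled : ∀ i j {e} → e ≡ diagonal E.0# E.6# i j → (w * w) * ι e ≈ δ i j
    scaled i j refl = w*w*diagonal i j

-- Exact verification of the quantum Latin square

ψ : Fin 6 → Fin 6 → Fin 6 → E.Carrier
ψ i j r = (E.ω E.^ toℕ (lookup (lookup A r) i)) E.* (E.ω E.^ toℕ (lookup (lookup B r) j))

-- Thus `ψ i j` is √6 times the entry. Because `ι E.ω` unfolds to `η`, the power law `ι-^` applies
-- directly.
Φ₃₂≈ : ∀ i j r → Φ₃₂ i j r ≈ fromℝ 1/√6 * ι (ψ i j r)
Φ₃₂≈ i j r = CS.*-congˡ {fromℝ 1/√6} (CS.sym (CS.trans (ι-* (E.ω E.^ a) (E.ω E.^ b))
  (CS.*-cong (ι-^ E.ω a) (ι-^ E.ω b))))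
  where
  a = toℕ (lookup (lookup A r) i)
  b = toℕ (lookup (lookup B r) j)

isHadamard? : (x : Fin 6 → Fin 6 → E.Carrier) → Dec (IsHadamard x)
isHadamard? x =
        (all? λ i → all? λ j → _ E.≟ diagonal E.0# E.6# i j)
  ×-dec (all? λ r → all? λ s → _ E.≟ diagonal E.0# E.6# r s)

-- A finite computation: every inner product is evaluated in ℚ(√-3) and compared by decidable
-- equality.
rows-hadamard : ∀ i → IsHadamard (λ j → ψ i j)
rows-hadamard = from-yes (all? λ i → isHadamard? λ j → ψ i j)

columns-hadamard : ∀ j → IsHadamard (λ i → ψ i j)
columns-hadamard = from-yes (all? λ j → isHadamard? λ i → ψ i j)

Φ₃₂-isQuantumLatinSquare : IsQuantumLatinSquare Φ₃₂
Φ₃₂-isQuantumLatinSquare = record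
  { unit    = λ i j → IsOrthonormalBasis.unit (rows i) j
  ; rows    = rows
  ; columns = λ j → hadamard⇒orthonormalBasis (fromℝ 1/√6) conj-1/√6 1/√6-square
      (λ i → Φ₃₂ i j) (λ i → ψ i j) (λ i → Φ₃₂≈ i j) (columns-hadamard j)
  }
  where
  rows : ∀ i → IsOrthonormalBasis (λ j → Φ₃₂ i j)
  rows i = hadamard⇒orthonormalBasis (fromℝ 1/√6) conj-1/√6 1/√6-square
    (λ j → Φ₃₂ i j) (λ j → ψ i j) (λ j → Φ₃₂≈ i j) (rows-hadamard i)

-- Counting the phase classes

-- The distinct vectors ψ i j, numbered in order of first appearance.

labels : Vec (Vec (Fin 32) 6) 6
labels = (#  0 ∷ #  1 ∷ #  2 ∷ #  3 ∷ #  4 ∷ #  5 ∷ [])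
       ∷ (#  6 ∷ #  7 ∷ #  8 ∷ #  9 ∷ # 10 ∷ # 11 ∷ [])
       ∷ (# 12 ∷ # 13 ∷ # 14 ∷ # 15 ∷ #  7 ∷ #  6 ∷ [])
       ∷ (# 16 ∷ # 17 ∷ # 18 ∷ # 19 ∷ # 20 ∷ # 21 ∷ [])
       ∷ (# 22 ∷ # 23 ∷ # 24 ∷ # 25 ∷ # 26 ∷ # 27 ∷ [])
       ∷ (# 28 ∷ # 29 ∷ #  6 ∷ #  7 ∷ # 30 ∷ # 31 ∷ [])
       ∷ []

label : Fin 6 × Fin 6 → Fin 32
label (i , j) = lookup (lookup labels i) j

-- Evaluation over all 36² pairs of positions. With `label-injective` it shows that the fibres of
-- `label` are exactly the classes of equal exact vectors.
label-cong : ∀ i j k l → (∀ r → ψ i j r ≡ ψ k l r) → label (i , j) ≡ label (k , l)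
label-cong = from-yes (all? λ i → all? λ j → all? λ k → all? λ l →
  (all? λ r → ψ i j r E.≟ ψ k l r) →-dec (label (i , j) Fin.≟ label (k , l)))

label-injective : ∀ i j k l → label (i , j) ≡ label (k , l) → ∀ r → ψ i j r ≡ ψ k l r
label-injective = from-yes (all? λ i → all? λ j → all? λ k → all? λ l →
  (label (i , j) Fin.≟ label (k , l)) →-dec (all? λ r → ψ i j r E.≟ ψ k l r))

label-surjective : ∀ y → ∃ λ i → ∃ λ j → label (i , j) ≡ y
label-surjective = from-yes (all? λ y → any? λ i → any? λ j → label (i , j) Fin.≟ y)

-- Row 0 of `A` and of `B` is zero. This common coordinate is what rules out a nontrivial phase.
ψ-0F : ∀ i j → ψ i j 0F ≡ E.1#
ψ-0F = from-yes (all? λ i → all? λ j → ψ i j 0F E.≟ E.1#)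

-- The 0th coordinate of every entry is 1/√6, which forces the phase to be 1.

∼⇒ψ≡ : ∀ i j k l → Φ₃₂ i j ∼ Φ₃₂ k l → ∀ r → ψ i j r ≡ ψ k l r
∼⇒ψ≡ i j k l (c , _ , Φ≋) r = ι-injective (begin
  ι (ψ i j r)      ≈⟨ scaled r ⟩
  c * ι (ψ k l r)  ≈⟨ CS.*-congʳ c≈1 ⟩
  1ℂ * ι (ψ k l r) ≈⟨ CS.*-identityˡ (ι (ψ k l r)) ⟩
  ι (ψ k l r)      ∎)
  where
  w = fromℝ 1/√6

  -- The phase commutes past 1/√6, which then cancels, leaving a relation between exact vectors.
  scaled : ∀ r → ι (ψ i j r) ≈ c * ι (ψ k l r)
  scaled r = w-cancelˡ w conj-1/√6 1/√6-square (begin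
    w * ι (ψ i j r)        ≈⟨ Φ₃₂≈ i j r ⟨
    Φ₃₂ i j r              ≈⟨ Φ≋ r ⟩
    c * Φ₃₂ k l r          ≈⟨ CS.*-congˡ {c} (Φ₃₂≈ k l r) ⟩
    c * (w * ι (ψ k l r))  ≈⟨ *-swapˡ c w (ι (ψ k l r)) ⟩
    w * (c * ι (ψ k l r))  ∎)

  ψ-0F≈1 : ∀ i j → ι (ψ i j 0F) ≈ 1ℂ
  ψ-0F≈1 i j = CS.trans (CS.reflexive (cong ι (ψ-0F i j))) ι-1

  c≈1 : c ≈ 1ℂ
  c≈1 = begin
    c                 ≈⟨ CS.*-identityʳ c ⟨
    c * 1ℂ            ≈⟨ CS.*-congˡ {c} (ψ-0F≈1 k l) ⟨
    c * ι (ψ k l 0F)  ≈⟨ scaled 0F ⟨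
    ι (ψ i j 0F)      ≈⟨ ψ-0F≈1 i j ⟩
    1ℂ                ∎

ψ≡⇒∼ : ∀ i j k l → (∀ r → ψ i j r ≡ ψ k l r) → Φ₃₂ i j ∼ Φ₃₂ k l
ψ≡⇒∼ i j k l ψ≡ = 1ℂ , ≗⇒≈ℝ (λ _ → refl) , λ r → begin
  Φ₃₂ i j r                 ≈⟨ Φ₃₂≈ i j r ⟩
  fromℝ 1/√6 * ι (ψ i j r)  ≈⟨ CS.*-congˡ {fromℝ 1/√6} (CS.reflexive (cong ι (ψ≡ r))) ⟩
  fromℝ 1/√6 * ι (ψ k l r)  ≈⟨ Φ₃₂≈ k l r ⟨
  Φ₃₂ k l r                 ≈⟨ CS.*-identityˡ (Φ₃₂ k l r) ⟨
  1ℂ * Φ₃₂ k l r            ∎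

Φ₃₂-hasCardinality : HasCardinality Φ₃₂ 32
Φ₃₂-hasCardinality = label
  , (λ {p} {q} → congruent p q)
  , (λ {p} {q} → injective p q)
  -- Surjectivity up to `∼` requires every entry in the class of the chosen preimage to receive the
  -- label `y`, hence the second use of `congruent`.
  , λ y → let i , j , eq = label-surjective y
          in (i , j) , λ {p} p∼ → trans (congruent p (i , j) p∼) eq
  where
  congruent : ∀ p q → SamePhaseClass Φ₃₂ p q → label p ≡ label q
  congruent (i , j) (k , l) p∼q = label-cong i j k l (∼⇒ψ≡ i j k l p∼q)

  injective : ∀ p q → label p ≡ label q → SamePhaseClass Φ₃₂ p q
  injective (i , j) (k , l) eq = ψ≡⇒∼ i j k l (label-injective i j k l eq)

theorem6 : IsQuantumLatinSquare Φ₃₂ × HasCardinality Φ₃₂ 32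
theorem6 = Φ₃₂-isQuantumLatinSquare , Φ₃₂-hasCardinality
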